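{- Let $B=F(b_1,\ldots,b_n)$ be a Ferrers board with $0\le b_1\le\cdots\le b_n$. Then, as polynomials in $x$, $$x^n=\sum_{k=0}^n\mathbf{rPT}_{n-k}(B,p,q,r)\,(x-P_{b_1}(p,q,r))(x-P_{b_2}(p,q,r))\cdots(x-P_{b_k}(p,q,r)),$$ where the empty product ($k=0$) equals 1.
   Context: For $m\ge1$, a $P$-tiling of height $m$ is a tiling of a column of height $m$ by tiles of heights 1, 2 and 3 whose bottom-most tile has height 1. $P_m(p,q,r)=\sum_T q^{\mathrm{one}(T)}p^{\mathrm{two}(T)}r^{\mathrm{three}(T)}$ over all $P$-tilings $T$ of height $m$, where $\mathrm{one},\mathrm{two},\mathrm{three}$ count tiles of height 1, 2, 3. There are no $P$-tilings of height 0 and $P_0(p,q,r)=0$. A Ferrers board $F(b_1,\ldots,b_n)$ has column heights $b_1,\ldots,b_n$ from left to right. A $P$-rook placement of $k$ tilings in $B=F(b_1,\ldots,b_n)$ is a choice of columns $1\le i_1<\cdots<i_k\le n$ with, for each $s=1,\ldots,k$, a $P$-tiling of height $b_{i_s-(s-1)}$ in column $i_s$ (the number of cells of column $i_s$ left uncanceled by earlier tilings, each tiling canceling top cells of columns to its right so that after $s$ tilings the untiled columns have $b_1,\ldots,b_{n-s}$ uncanceled cells). Its weight is $q^ap^br^c$ with $a,b,c$ the total numbers of tiles of height 1, 2, 3 used. $\mathbf{rPT}_k(B,p,q,r)$ is the sum of the weights of all $P$-rook placements of $k$ tilings in $B$ (the empty placement has weight 1). -}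

module Defs where

open import Algebra.Bundles using (CommutativeRing)
open import Algebra.Structures using (IsCommutativeRing)
import Algebra.Properties.Monoid.Sum as Sum
import Algebra.Properties.Semiring.Exp as Exp
open import Data.Empty using (⊥; ⊥-elim)
open import Data.Fin.Base using (Fin; zero; suc; toℕ; inject₁; _<_)
import Data.Fin.Properties as Fin
open import Data.List.Base as List
  using (List; []; _∷_; _++_; concat; concatMap; filter; foldr; head; length)
import Data.List.Properties as List
open import Data.List.Membership.Propositional using (_∈_)
open import Data.List.Membership.Propositional.Properties
open import Data.List.Relation.Unary.All as All using ([]; _∷_)
open import Data.List.Relation.Unary.AllPairs using ([]; _∷_)
open import Data.List.Relation.Unary.Any using (here; there)
open import Data.List.Relation.Unary.Unique.Propositional using (Unique)
import Data.List.Relation.Unary.Unique.Propositional.Properties as Unique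
open import Data.Maybe.Base using (just)
open import Data.Nat.Base as ℕ using (ℕ; zero; suc; s≤s; z≤n; _∸_)
open import Data.Nat.ListAction using (sum)
import Data.Nat.Properties as ℕ
open import Data.Product.Base using (∃; _×_; _,_; proj₁; proj₂)
import Data.Product.Properties as Product
open import Data.Sum.Base using (_⊎_; inj₁; inj₂)
open import Data.Vec.Base as Vec using (Vec; []; _∷_; lookup)
import Data.Vec.Properties as Vec
open import Data.Vec.Relation.Unary.All as VecAll using ([]; _∷_)
import Data.Vec.Relation.Unary.All.Properties as VecAll
open import Data.Vec.Relation.Unary.AllPairs using (AllPairs; []; _∷_)
open import Function.Base using (_∘_)
open import Level using (Level; _⊔_)
open import Relation.Binary.PropositionalEquality as ≡
  using (_≡_; refl; cong; cong₂)
open import Relation.Nullary.Decidable using (Dec; yes; no)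
open import Relation.Nullary.Negation using (¬_)

private
  variable
    a b p q : Level
    A : Set a
    B : Set b
    k m n : ℕ

------------------------------------------------------------------------
-- Finite sets of objects, listed without repetition

record Enumeration {A : Set a} (P : A → Set p) : Set (a ⊔ p) where
  field
    list     : List A
    sound    : ∀ {x} → x ∈ list → P x
    complete : ∀ {x} → P x → x ∈ list
    unique   : Unique list

open Enumeration

module _ {A : Set a} where

  emptyᴱ : {P : A → Set p} → (∀ {x} → ¬ P x) → Enumeration P
  emptyᴱ ¬P = record
    { list = [] ; sound = λ () ; complete = λ Px → ⊥-elim (¬P Px) ; unique = [] }

  singletonᴱ : {P : A → Set p} (x : A) → P x → (∀ {y} → P y → y ≡ x) → Enumeration P
  singletonᴱ x Px only = record
    { list     = x ∷ []
    ; sound    = λ { (here refl) → Px }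
    ; complete = λ Py → here (only Py)
    ; unique   = [] ∷ []
    }

  -- P is the disjoint union of Q₁ and Q₂.
  unionᴱ : {P : A → Set p} {Q₁ Q₂ : A → Set q} →
           Enumeration Q₁ → Enumeration Q₂ →
           (∀ {x} → Q₁ x → P x) → (∀ {x} → Q₂ x → P x) →
           (∀ {x} → P x → Q₁ x ⊎ Q₂ x) →
           (∀ {x} → Q₁ x → Q₂ x → ⊥) →
           Enumeration P
  unionᴱ {P = P} E₁ E₂ in₁ in₂ cover disjoint = record
    { list     = list E₁ ++ list E₂
    ; sound    = sound′
    ; complete = complete′
    ; unique   = Unique.++⁺ (unique E₁) (unique E₂)
                   λ (x∈₁ , x∈₂) → disjoint (sound E₁ x∈₁) (sound E₂ x∈₂)
    }
    where
    sound′ : ∀ {x} → x ∈ list E₁ ++ list E₂ → P x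
    sound′ x∈ with ∈-++⁻ (list E₁) x∈
    ... | inj₁ x∈₁ = in₁ (sound E₁ x∈₁)
    ... | inj₂ x∈₂ = in₂ (sound E₂ x∈₂)

    complete′ : ∀ {x} → P x → x ∈ list E₁ ++ list E₂
    complete′ Px with cover Px
    ... | inj₁ Q₁x = ∈-++⁺ˡ (complete E₁ Q₁x)
    ... | inj₂ Q₂x = ∈-++⁺ʳ (list E₁) (complete E₂ Q₂x)

module _ {A : Set a} {B : Set b} where

  -- f restricts to a bijection from P to Q.
  mapᴱ : {P : A → Set p} {Q : B → Set q} (f : A → B) →
         (∀ {x y} → f x ≡ f y → x ≡ y) →
         (∀ {x} → P x → Q (f x)) →
         (∀ {y} → Q y → ∃ λ x → P x × y ≡ f x) →
         Enumeration P → Enumeration Q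
  mapᴱ {P = P} {Q = Q} f injective into onto E = record
    { list     = List.map f (list E)
    ; sound    = sound′
    ; complete = complete′
    ; unique   = Unique.map⁺ injective (unique E)
    }
    where
    sound′ : ∀ {y} → y ∈ List.map f (list E) → Q y
    sound′ y∈ with ∈-map⁻ f y∈
    ... | x , x∈ , refl = into (sound E x∈)

    complete′ : ∀ {y} → Q y → y ∈ List.map f (list E)
    complete′ Qy with onto Qy
    ... | x , Px , refl = ∈-map⁺ f (complete E Px)

  Σᴱ : {P : A → Set p} {Q : A → B → Set q} →
       Enumeration P → (∀ x → Enumeration (Q x)) →
       Enumeration (λ (x , y) → P x × Q x y)
  Σᴱ {P = P} {Q = Q} E F = record
    { list     = pairs (list E)
    ; sound    = λ xy∈ → let x∈ , y∈ = split (list E) xy∈ in sound E x∈ , sound (F _) y∈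
    ; complete = λ (Px , Qxy) → join (complete E Px) (complete (F _) Qxy)
    ; unique   = pairs-unique (unique E)
    }
    where
    fibre : A → List (A × B)
    fibre x = List.map (x ,_) (list (F x))

    pairs : List A → List (A × B)
    pairs = concatMap fibre

    split : ∀ xs {x y} → (x , y) ∈ pairs xs → x ∈ xs × y ∈ list (F x)
    split (x′ ∷ xs) xy∈ with ∈-++⁻ (fibre x′) xy∈
    ... | inj₂ xy∈′ = let x∈ , y∈ = split xs xy∈′ in there x∈ , y∈
    ... | inj₁ xy∈′ with ∈-map⁻ (x′ ,_) xy∈′
    ...   | _ , y∈ , refl = here refl , y∈

    join : ∀ {xs x y} → x ∈ xs → y ∈ list (F x) → (x , y) ∈ pairs xs
    join             (here refl) y∈ = ∈-++⁺ˡ (∈-map⁺ _ y∈)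
    join {x′ ∷ xs}   (there x∈)  y∈ = ∈-++⁺ʳ (fibre x′) (join x∈ y∈)

    pairs-unique : ∀ {xs} → Unique xs → Unique (pairs xs)
    pairs-unique [] = []
    pairs-unique {x ∷ xs} (x∉xs ∷ u) =
      Unique.++⁺ (Unique.map⁺ Product.,-injectiveʳ (unique (F x))) (pairs-unique u)
        λ (z∈₁ , z∈₂) → clash z∈₁ z∈₂
      where
      clash : ∀ {z} → z ∈ fibre x → z ∈ pairs xs → ⊥
      clash z∈₁ z∈₂ with ∈-map⁻ (x ,_) z∈₁
      ... | _ , _ , refl = All.lookup x∉xs (proj₁ (split xs z∈₂)) refl

Πᴱ : {A : Set a} {P : Fin k → A → Set p} → (∀ s → Enumeration (P s)) →
     Enumeration (λ (v : Vec A k) → ∀ s → P s (lookup v s))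
Πᴱ {k = zero}  E = singletonᴱ [] (λ ()) λ { {[]} _ → refl }
Πᴱ {k = suc k} {P = P} E =
  mapᴱ (λ (x , v) → x ∷ v)
       (λ { {_ , _} {_ , _} refl → refl })
       (λ { (Px , Pv) zero → Px ; (Px , Pv) (suc s) → Pv s })
       (λ { {x ∷ v} Pxv → (x , v) , (Pxv zero , Pxv ∘ suc) , refl })
       (Σᴱ (E zero) (λ _ → Πᴱ (E ∘ suc)))

------------------------------------------------------------------------
-- Tilings of a column

data Tile : Set where
  one two three : Tile

height : Tile → ℕ
height one   = 1
height two   = 2
height three = 3

_≟_ : (s t : Tile) → Dec (s ≡ t)
one   ≟ one   = yes refl
one   ≟ two   = no λ ()
one   ≟ three = no λ ()
two   ≟ one   = no λ ()
two   ≟ two   = yes refl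
two   ≟ three = no λ ()
three ≟ one   = no λ ()
three ≟ two   = no λ ()
three ≟ three = yes refl

-- The tiles of a column, listed from bottom to top.
Tiling : Set
Tiling = List Tile

total : Tiling → ℕ
total T = sum (List.map height T)

count : Tile → Tiling → ℕ
count t T = length (filter (t ≟_) T)

IsTiling : ℕ → Tiling → Set
IsTiling m T = total T ≡ m

-- The second condition rules out the empty tiling of a column of height 0.
IsPTiling : ℕ → Tiling → Set
IsPTiling m T = IsTiling m T × head T ≡ just one

private
  StartsWith : Tile → ℕ → Tiling → Set
  StartsWith t m T = ∃ λ T′ → IsTiling m T′ × T ≡ t ∷ T′

  startsWith : (t : Tile) → Enumeration (IsTiling m) → Enumeration (StartsWith t m)
  startsWith t = mapᴱ (t ∷_) List.∷-injectiveʳ (λ T! → _ , T! , refl) (λ T! → T!)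

  disjoint : ∀ {s t T} → ¬ s ≡ t → StartsWith s k T → StartsWith t m T → ⊥
  disjoint s≢t (_ , _ , refl) (_ , _ , refl) = s≢t refl

tilings : ∀ m → Enumeration (IsTiling m)
tilings 0 = singletonᴱ [] refl λ
  { {[]} _ → refl ; {one ∷ _} () ; {two ∷ _} () ; {three ∷ _} () }
tilings 1 = mapᴱ (one ∷_) List.∷-injectiveʳ (cong suc)
  (λ { {one ∷ T} eq → T , ℕ.suc-injective eq , refl
     ; {two ∷ _} () ; {three ∷ _} () })
  (tilings 0)
tilings 2 = unionᴱ (startsWith one (tilings 1)) (startsWith two (tilings 0))
  (λ { (_ , eq , refl) → cong (1 ℕ.+_) eq })
  (λ { (_ , eq , refl) → cong (2 ℕ.+_) eq })
  (λ { {one ∷ T} eq → inj₁ (T , ℕ.+-cancelˡ-≡ 1 _ _ eq , refl)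
     ; {two ∷ T} eq → inj₂ (T , ℕ.+-cancelˡ-≡ 2 _ _ eq , refl)
     ; {three ∷ _} () })
  (disjoint λ ())
tilings (suc (suc (suc m))) =
  unionᴱ {Q₂ = λ T → StartsWith two (suc m) T ⊎ StartsWith three m T}
  (startsWith one (tilings (suc (suc m))))
  (unionᴱ (startsWith two (tilings (suc m))) (startsWith three (tilings m))
    inj₁ inj₂ (λ T! → T!) (disjoint λ ()))
  (λ { (_ , eq , refl) → cong (1 ℕ.+_) eq })
  (λ { (inj₁ (_ , eq , refl)) → cong (2 ℕ.+_) eq
     ; (inj₂ (_ , eq , refl)) → cong (3 ℕ.+_) eq })
  (λ { {one   ∷ T} eq → inj₁ (T , ℕ.+-cancelˡ-≡ 1 _ _ eq , refl)
     ; {two   ∷ T} eq → inj₂ (inj₁ (T , ℕ.+-cancelˡ-≡ 2 _ _ eq , refl))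
     ; {three ∷ T} eq → inj₂ (inj₂ (T , ℕ.+-cancelˡ-≡ 3 _ _ eq , refl)) })
  (λ { o (inj₁ t) → disjoint (λ ()) o t ; o (inj₂ t) → disjoint (λ ()) o t })

pTilings : ∀ m → Enumeration (IsPTiling m)
pTilings zero = emptyᴱ λ
  { {[]} (_ , ()) ; {one ∷ _} (() , _) ; {two ∷ _} (() , _) ; {three ∷ _} (() , _) }
pTilings (suc m) = mapᴱ (one ∷_) List.∷-injectiveʳ
  (λ eq → cong suc eq , refl)
  (λ { {one ∷ T} (eq , _) → T , ℕ.suc-injective eq , refl
     ; {two ∷ _} (_ , ()) ; {three ∷ _} (_ , ()) ; {[]} (_ , ()) })
  (tilings m)

------------------------------------------------------------------------
-- Rook placements

-- Column heights from left to right; columns are indexed from 0.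
Board : ℕ → Set
Board n = Fin n → ℕ

_⊖_ : Fin n → ℕ → Fin n
i     ⊖ zero  = i
zero  ⊖ suc s = zero
suc i ⊖ suc s = inject₁ (i ⊖ s)

toℕ-⊖ : ∀ (i : Fin n) s → toℕ (i ⊖ s) ≡ toℕ i ∸ s
toℕ-⊖ i       zero    = refl
toℕ-⊖ zero    (suc s) = refl
toℕ-⊖ (suc i) (suc s) = ≡.trans (Fin.toℕ-inject₁ (i ⊖ s)) (toℕ-⊖ i s)

IsIncreasing : Vec (Fin n) k → Set
IsIncreasing = AllPairs _<_

-- The chosen columns together with the tilings placed in them.
Placement : ℕ → ℕ → Set
Placement n k = Vec (Fin n) k × Vec Tiling k

-- With columns and tilings both counted from 0, tiling number s has s
-- predecessors, so that column i has b (i ∸ s) uncanceled cells.  In an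
-- increasing sequence of columns s never exceeds i.
IsPRookPlacement : Board n → Placement n k → Set
IsPRookPlacement b (columns , Ts) =
  IsIncreasing columns ×
  (∀ s → IsPTiling (b (lookup columns s ⊖ toℕ s)) (lookup Ts s))

private
  shift : Vec (Fin n) k → Vec (Fin (suc n)) k
  shift = Vec.map suc

  increasing-suc : {v : Vec (Fin n) k} → IsIncreasing v → IsIncreasing (shift v)
  increasing-suc []         = []
  increasing-suc (lt ∷ inc) = VecAll.map⁺ (VecAll.map s≤s lt) ∷ increasing-suc inc

  increasing-pred : {v : Vec (Fin n) k} → IsIncreasing (shift v) → IsIncreasing v
  increasing-pred {v = []}    []         = []
  increasing-pred {v = _ ∷ _} (lt ∷ inc) =
    VecAll.map ℕ.s≤s⁻¹ (VecAll.map⁻ lt) ∷ increasing-pred inc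

  positive : (j : Fin (suc n)) (v : Vec (Fin (suc n)) k) → VecAll.All (j <_) v →
             ∃ λ w → v ≡ shift w
  positive j []          []         = [] , refl
  positive j (suc i ∷ v) (_ ∷ pos) with positive j v pos
  ... | w , refl = i ∷ w , refl

  all-positive : (w : Vec (Fin n) k) → VecAll.All (zero {n} <_) (shift w)
  all-positive []      = []
  all-positive (i ∷ w) = s≤s z≤n ∷ all-positive w

  map-suc-injective : {v w : Vec (Fin n) k} → shift v ≡ shift w → v ≡ w
  map-suc-injective {v = []}    {[]}    _  = refl
  map-suc-injective {v = _ ∷ _} {_ ∷ _} eq =
    cong₂ _∷_ (Fin.suc-injective (Vec.∷-injectiveˡ eq)) (map-suc-injective (Vec.∷-injectiveʳ eq))

  UsesFirst AvoidsFirst : Vec (Fin (suc n)) (suc k) → Set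
  UsesFirst   v = ∃ λ w → IsIncreasing w × v ≡ zero ∷ shift w
  AvoidsFirst v = ∃ λ w → IsIncreasing w × v ≡ shift w

  usesOrAvoids : {v : Vec (Fin (suc n)) (suc k)} → IsIncreasing v →
                 UsesFirst v ⊎ AvoidsFirst v
  usesOrAvoids {v = zero ∷ v} (lt ∷ inc) with positive zero v lt
  ... | w , refl = inj₁ (w , increasing-pred inc , refl)
  usesOrAvoids {v = suc i ∷ v} (lt ∷ inc) with positive (suc i) v lt
  ... | w , refl = inj₂ (i ∷ w , increasing-pred {v = i ∷ w} (lt ∷ inc) , refl)

increasing : ∀ n k → Enumeration (IsIncreasing {n} {k})
increasing n       zero    = singletonᴱ [] [] λ { {[]} _ → refl }
increasing zero    (suc k) = emptyᴱ λ { {() ∷ _} }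
increasing (suc n) (suc k) = unionᴱ {Q₁ = UsesFirst} {Q₂ = AvoidsFirst}
  (mapᴱ (λ w → zero ∷ shift w) (map-suc-injective ∘ Vec.∷-injectiveʳ)
    (λ inc → _ , inc , refl) (λ v! → v!) (increasing n k))
  (mapᴱ shift map-suc-injective
    (λ inc → _ , inc , refl) (λ v! → v!) (increasing n (suc k)))
  (λ { (w , inc , refl) → all-positive w ∷ increasing-suc inc })
  (λ { (w , inc , refl) → increasing-suc inc })
  usesOrAvoids
  (λ { (_ , _ , refl) (_ ∷ _ , _ , ()) })

pRookPlacements : (b : Board n) (k : ℕ) → Enumeration (IsPRookPlacement {n} {k} b)
pRookPlacements {n} b k =
  Σᴱ (increasing n k) λ columns → Πᴱ λ s → pTilings (b (lookup columns s ⊖ toℕ s))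

module RookPolynomials {c ℓ} (R : CommutativeRing c ℓ) where

  open CommutativeRing R
  open Exp semiring using (_^_)

  ∑ : {A : Set a} {P : A → Set p} → Enumeration P → (A → Carrier) → Carrier
  ∑ E f = foldr _+_ 0# (List.map f (list E))

  weight : (p q r : Carrier) → Tiling → Carrier
  weight p q r T = q ^ count one T * p ^ count two T * r ^ count three T

  P : ℕ → (p q r : Carrier) → Carrier
  P m p q r = ∑ (pTilings m) (weight p q r)

  rPT : ℕ → Board n → (p q r : Carrier) → Carrier
  rPT k b p q r =
    ∑ (pRookPlacements b k) λ (_ , Ts) → weight p q r (concat (Vec.toList Ts))

------------------------------------------------------------------------
-- Polynomials in one variable over a commutative ring

module Polynomial {c ℓ} (R : CommutativeRing c ℓ) where

  private module R = CommutativeRing R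
  open R using (Carrier; _≈_; 0#; 1#)
  open import Algebra.Properties.Ring R.ring using (-0#≈0#)

  -- Coefficients in order of increasing degree; trailing zeros are allowed.
  Poly : Set c
  Poly = List Carrier

  coeff : Poly → ℕ → Carrier
  coeff []      i       = 0#
  coeff (a ∷ f) zero    = a
  coeff (a ∷ f) (suc i) = coeff f i

  infix 4 _≋_

  record _≋_ (f g : Poly) : Set ℓ where
    constructor coeffwise
    field at : ∀ i → coeff f i ≈ coeff g i

  open _≋_

  infixl 6 _+_
  infixl 7 _*_ _·_
  infix  8 -_

  _+_ : Poly → Poly → Poly
  []      + g       = g
  (a ∷ f) + []      = a ∷ f
  (a ∷ f) + (b ∷ g) = (a R.+ b) ∷ (f + g)

  -_ : Poly → Poly
  - f = List.map (λ a → R.- a) f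

  _·_ : Carrier → Poly → Poly
  a · f = List.map (a R.*_) f

  _*_ : Poly → Poly → Poly
  []      * g = []
  (a ∷ f) * g = a · g + (0# ∷ f * g)

  C : Carrier → Poly
  C a = a ∷ []

  X : Poly
  X = 0# ∷ 1# ∷ []

  private
    ≋-refl : ∀ {f} → f ≋ f
    ≋-refl .at i = R.refl

    ≋-sym : ∀ {f g} → f ≋ g → g ≋ f
    ≋-sym e .at i = R.sym (at e i)

    ≋-trans : ∀ {f g h} → f ≋ g → g ≋ h → f ≋ h
    ≋-trans d e .at i = R.trans (at d i) (at e i)

    ∷-cong : ∀ {a b f g} → a ≈ b → f ≋ g → (a ∷ f) ≋ (b ∷ g)
    ∷-cong d e .at zero    = d
    ∷-cong d e .at (suc i) = at e i

    0∷[] : (0# ∷ []) ≋ []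
    0∷[] .at zero    = R.refl
    0∷[] .at (suc i) = R.refl

    coeff-+ : ∀ f g i → coeff (f + g) i ≈ coeff f i R.+ coeff g i
    coeff-+ []      g       i       = R.sym (R.+-identityˡ _)
    coeff-+ (a ∷ f) []      i       = R.sym (R.+-identityʳ _)
    coeff-+ (a ∷ f) (b ∷ g) zero    = R.refl
    coeff-+ (a ∷ f) (b ∷ g) (suc i) = coeff-+ f g i

    coeff-neg : ∀ f i → coeff (- f) i ≈ R.- coeff f i
    coeff-neg []      i       = R.sym -0#≈0#
    coeff-neg (a ∷ f) zero    = R.refl
    coeff-neg (a ∷ f) (suc i) = coeff-neg f i

    coeff-· : ∀ a f i → coeff (a · f) i ≈ a R.* coeff f i
    coeff-· a []      i       = R.sym (R.zeroʳ a)
    coeff-· a (b ∷ f) zero    = R.refl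
    coeff-· a (b ∷ f) (suc i) = coeff-· a f i

    +-cong : ∀ {f f′ g g′} → f ≋ f′ → g ≋ g′ → f + g ≋ f′ + g′
    +-cong {f} {f′} {g} {g′} d e .at i =
      R.trans (coeff-+ f g i) (R.trans (R.+-cong (at d i) (at e i)) (R.sym (coeff-+ f′ g′ i)))

    +-assoc : ∀ f g h → (f + g) + h ≋ f + (g + h)
    +-assoc f g h .at i =
      R.trans (R.trans (coeff-+ (f + g) h i) (R.+-congʳ (coeff-+ f g i)))
      (R.trans (R.+-assoc _ _ _)
      (R.sym (R.trans (coeff-+ f (g + h) i) (R.+-congˡ (coeff-+ g h i)))))

    +-comm : ∀ f g → f + g ≋ g + f
    +-comm f g .at i =
      R.trans (coeff-+ f g i) (R.trans (R.+-comm _ _) (R.sym (coeff-+ g f i)))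

    +-identityʳ : ∀ f → f + [] ≋ f
    +-identityʳ f = +-comm f []

    neg-cong : ∀ {f g} → f ≋ g → - f ≋ - g
    neg-cong {f} {g} e .at i =
      R.trans (coeff-neg f i) (R.trans (R.-‿cong (at e i)) (R.sym (coeff-neg g i)))

    neg-inverseˡ : ∀ f → - f + f ≋ []
    neg-inverseˡ f .at i =
      R.trans (coeff-+ (- f) f i) (R.trans (R.+-congʳ (coeff-neg f i)) (R.-‿inverseˡ _))

    +-interchange : ∀ f g h k → (f + g) + (h + k) ≋ (f + h) + (g + k)
    +-interchange f g h k =
      ≋-trans (+-assoc f g (h + k)) (≋-trans (+-cong (≋-refl {f})
        (≋-trans (≋-sym (+-assoc g h k))
        (≋-trans (+-cong (+-comm g h) (≋-refl {k})) (+-assoc h g k))))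
      (≋-sym (+-assoc f h (g + k))))

    ·-cong : ∀ {a b f g} → a ≈ b → f ≋ g → a · f ≋ b · g
    ·-cong {a} {b} {f} {g} d e .at i =
      R.trans (coeff-· a f i) (R.trans (R.*-cong d (at e i)) (R.sym (coeff-· b g i)))

    ·-zeroˡ : ∀ {a} f → a ≈ 0# → a · f ≋ []
    ·-zeroˡ f d .at i = R.trans (coeff-· _ f i) (R.trans (R.*-congʳ d) (R.zeroˡ _))

    ·-identity : ∀ f → 1# · f ≋ f
    ·-identity f .at i = R.trans (coeff-· 1# f i) (R.*-identityˡ _)

    ·-distribˡ : ∀ a f g → a · (f + g) ≋ a · f + a · g
    ·-distribˡ a f g .at i =
      R.trans (coeff-· a (f + g) i) (R.trans (R.*-congˡ (coeff-+ f g i))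
      (R.trans (R.distribˡ _ _ _)
      (R.sym (R.trans (coeff-+ (a · f) (a · g) i) (R.+-cong (coeff-· a f i) (coeff-· a g i))))))

    ·-distribʳ : ∀ a b f → (a R.+ b) · f ≋ a · f + b · f
    ·-distribʳ a b f .at i =
      R.trans (coeff-· (a R.+ b) f i) (R.trans (R.distribʳ _ _ _)
      (R.sym (R.trans (coeff-+ (a · f) (b · f) i) (R.+-cong (coeff-· a f i) (coeff-· b f i)))))

    ·-assoc : ∀ a b f → (a R.* b) · f ≋ a · (b · f)
    ·-assoc a b f .at i =
      R.trans (coeff-· (a R.* b) f i) (R.trans (R.*-assoc _ _ _)
      (R.sym (R.trans (coeff-· a (b · f) i) (R.*-congˡ (coeff-· b f i)))))

    ·-shift : ∀ a f → a · (0# ∷ f) ≋ (0# ∷ a · f)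
    ·-shift a f = ∷-cong (R.zeroʳ a) ≋-refl

    shift-+ : ∀ f g → (0# ∷ f + g) ≋ (0# ∷ f) + (0# ∷ g)
    shift-+ f g = ∷-cong (R.sym (R.+-identityˡ 0#)) ≋-refl

    *-congˡ : ∀ f {g g′} → g ≋ g′ → f * g ≋ f * g′
    *-congˡ []      e = ≋-refl
    *-congˡ (a ∷ f) e = +-cong (·-cong R.refl e) (∷-cong R.refl (*-congˡ f e))

    *-zeroʳ : ∀ f → f * [] ≋ []
    *-zeroʳ []      = ≋-refl
    *-zeroʳ (a ∷ f) = ≋-trans (∷-cong R.refl (*-zeroʳ f)) 0∷[]

    *-∷ : ∀ f b g → f * (b ∷ g) ≋ b · f + (0# ∷ f * g)
    *-∷ []      b g = ≋-sym 0∷[]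
    *-∷ (a ∷ f) b g = ∷-cong (R.+-congʳ (R.*-comm a b))
      (≋-trans (+-cong (≋-refl {a · g}) (*-∷ f b g))
      (≋-trans (≋-sym (+-assoc (a · g) (b · f) _))
      (≋-trans (+-cong (+-comm (a · g) (b · f)) ≋-refl)
               (+-assoc (b · f) (a · g) _))))

    *-comm : ∀ f g → f * g ≋ g * f
    *-comm []      g = ≋-sym (*-zeroʳ g)
    *-comm (a ∷ f) g =
      ≋-trans (+-cong (≋-refl {a · g}) (∷-cong R.refl (*-comm f g))) (≋-sym (*-∷ g a f))

    *-cong : ∀ {f f′ g g′} → f ≋ f′ → g ≋ g′ → f * g ≋ f′ * g′
    *-cong {f} {f′} {g} {g′} d e =
      ≋-trans (*-congˡ f e)
      (≋-trans (*-comm f g′) (≋-trans (*-congˡ g′ d) (*-comm g′ f′)))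

    *-distribʳ : ∀ h f g → (f + g) * h ≋ f * h + g * h
    *-distribʳ h []      g       = ≋-refl
    *-distribʳ h (a ∷ f) []      = ≋-sym (+-identityʳ _)
    *-distribʳ h (a ∷ f) (b ∷ g) =
      ≋-trans (+-cong (·-distribʳ a b h)
        (≋-trans (∷-cong R.refl (*-distribʳ h f g)) (shift-+ (f * h) (g * h))))
      (+-interchange (a · h) (b · h) _ _)

    *-distribˡ : ∀ f g h → f * (g + h) ≋ f * g + f * h
    *-distribˡ f g h =
      ≋-trans (*-comm f (g + h)) (≋-trans (*-distribʳ f g h)
        (+-cong (*-comm g f) (*-comm h f)))

    ·-* : ∀ a f g → (a · f) * g ≋ a · (f * g)
    ·-* a []      g = ≋-refl
    ·-* a (b ∷ f) g =
      ≋-trans (+-cong (·-assoc a b g)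
        (≋-trans (∷-cong R.refl (·-* a f g)) (≋-sym (·-shift a (f * g)))))
      (≋-sym (·-distribˡ a (b · g) _))

    shift-* : ∀ f g → (0# ∷ f) * g ≋ (0# ∷ f * g)
    shift-* f g = +-cong (·-zeroˡ g R.refl) ≋-refl

    *-assoc : ∀ f g h → (f * g) * h ≋ f * (g * h)
    *-assoc []      g h = ≋-refl
    *-assoc (a ∷ f) g h =
      ≋-trans (*-distribʳ h (a · g) (0# ∷ f * g))
      (+-cong (·-* a g h) (≋-trans (shift-* (f * g) h) (∷-cong R.refl (*-assoc f g h))))

    *-identityˡ : ∀ f → C 1# * f ≋ f
    *-identityˡ f = ≋-trans (+-cong (·-identity f) 0∷[]) (+-identityʳ f)

  isCommutativeRing : IsCommutativeRing _≋_ _+_ _*_ -_ [] (C 1#)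
  isCommutativeRing = record
    { isRing = record
      { +-isAbelianGroup = record
        { isGroup = record
          { isMonoid = record
            { isSemigroup = record
              { isMagma = record
                { isEquivalence = record
                  { refl = ≋-refl ; sym = ≋-sym ; trans = ≋-trans }
                ; ∙-cong = +-cong
                }
              ; assoc = +-assoc
              }
            ; identity = (λ f → ≋-refl) , +-identityʳ
            }
          ; inverse = neg-inverseˡ , λ f → ≋-trans (+-comm f (- f)) (neg-inverseˡ f)
          ; ⁻¹-cong = neg-cong
          }
        ; comm = +-comm
        }
      ; *-cong = *-cong
      ; *-assoc = *-assoc
      ; *-identity = *-identityˡ , λ f → ≋-trans (*-comm f (C 1#)) (*-identityˡ f)
      ; distrib = *-distribˡ , *-distribʳ
      }
    ; *-comm = *-comm
    }

_[X] : ∀ {c ℓ} → CommutativeRing c ℓ → CommutativeRing c ℓ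
R [X] = record { isCommutativeRing = Polynomial.isCommutativeRing R }

module RingOperators {c ℓ} (R : CommutativeRing c ℓ) where

  open CommutativeRing R public using (Carrier; _≈_; _*_; _-_)
  open CommutativeRing R using (semiring; +-monoid; *-monoid)
  open Exp semiring public using (_^_)
  open Sum +-monoid public using (sum⁺-syntax)
  open Sum *-monoid public renaming (sum to product) using ()

  infixl 10 product-syntax

  product-syntax : ∀ n → (Fin n → Carrier) → Carrier
  product-syntax n = product

  syntax product-syntax n (λ i → x) = ∏[ i < n ] x

module Submission where

-- Avoiding or using the first column shows that rPT_k (B) is the complete
-- homogeneous symmetric polynomial of degree k in P_{b_1}, …, P_{b_{n-k+1}}.
-- For arbitrary a_1, …, a_n in place of the P_{b_i}, the same recursion turns
-- the right-hand side for n + 1 into a_1 x^n + (x - a_1) x^n.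

open import Defs
open import Algebra.Bundles using (CommutativeRing)
import Algebra.Properties.CommutativeSemigroup as CommutativeSemigroup
import Algebra.Properties.Monoid.Sum as MonoidSum
import Algebra.Properties.Semiring.Exp as Exp
import Algebra.Properties.Semiring.Sum as SemiringSum
open import Data.Fin.Base as Fin using (Fin; toℕ; inject!; zero; suc; inject₁; fromℕ)
import Data.Fin.Properties as Fin
open import Data.List.Base as List using (List; []; _∷_; _++_; concat; concatMap; foldr; length)
import Data.List.Properties as List
open import Data.List.Membership.Propositional using (_∈_)
open import Data.List.Relation.Unary.Any using (here; there)
open import Data.Nat.Base as ℕ using (ℕ; _∸_; zero; suc; z≤n; s≤s)
import Data.Nat.Properties as ℕ
open import Data.Product.Base using (_,_)
open import Data.Vec.Base as Vec using (Vec; []; _∷_; lookup)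
import Data.Vec.Properties as Vec
open import Data.Vec.Relation.Unary.All as VecAll using (All; _∷_)
open import Data.Vec.Relation.Unary.AllPairs using (_∷_)
open import Function.Base using (_∘_)
open import Level using (Level)
open import Relation.Binary.Core using (_Preserves_⟶_)
open import Relation.Binary.PropositionalEquality as ≡ using (_≡_; cong)
import Relation.Binary.Reasoning.Setoid as SetoidReasoning

open Enumeration

private
  variable
    ℓ₁ ℓ₂ : Level
    A : Set ℓ₁
    B : Set ℓ₂
    k m n : ℕ

-- Positions in an increasing choice of columns

-- Columns grow by at least one per position. The lower bound `m` is kept general so that it can
-- rise by one on the tail; at `m = 0` the result says that `⊖` never truncates on a placement.
index≤-increasing : {v : Vec (Fin n) k} → All ((m ℕ.≤_) ∘ toℕ) v → IsIncreasing v →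
                    ∀ s → m ℕ.+ toℕ s ℕ.≤ toℕ (lookup v s)
index≤-increasing {m = m} (m≤i ∷ _) _ zero =
  ℕ.≤-trans (ℕ.≤-reflexive (ℕ.+-identityʳ m)) m≤i
index≤-increasing {m = m} (m≤i ∷ _) (i<v ∷ inc) (suc s) =
  ℕ.≤-trans (ℕ.≤-reflexive (ℕ.+-suc m (toℕ s)))
    (index≤-increasing (VecAll.map (ℕ.≤-<-trans m≤i) i<v) inc s)

-- The bound excludes truncation: for `i = 0` and `s = 1` the left side would be 0 and the right
-- side 1.
suc-⊖ : ∀ (i : Fin n) {s} → s ℕ.≤ toℕ i → suc i ⊖ s ≡ suc (i ⊖ s)
suc-⊖ i       {zero}  _         = ≡.refl
suc-⊖ (suc i) {suc s} (s≤s s≤i) = cong inject₁ (suc-⊖ i s≤i)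

count-++ : ∀ t T T′ → count t (T ++ T′) ≡ count t T ℕ.+ count t T′
count-++ t T T′ =
  ≡.trans (cong length (List.filter-++ (t ≟_) T T′)) (List.length-++ (List.filter (t ≟_) T))

-- Complete homogeneous symmetric polynomials

module _ {c ℓ} (R : CommutativeRing c ℓ) where

  open CommutativeRing R hiding (zero)

  -- For 1 ≤ k ≤ n, h n k a is the complete homogeneous symmetric polynomial of
  -- degree k in a 0, …, a (n ∸ k).
  h : ∀ n → ℕ → (Fin n → Carrier) → Carrier
  h n       zero    a = 1#
  h zero    (suc k) a = 0#
  h (suc n) (suc k) a = a zero * h n k (a ∘ inject₁) + h n (suc k) (a ∘ suc)

  -- Both summands of the recursion keep the degree above the number of variables, down to `n = 0`.
  -- Combinatorially, `n` columns do not contain `k` distinct ones.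
  h-vanishes : n ℕ.< k → (a : Fin n → Carrier) → h n k a ≈ 0#
  h-vanishes {zero}  (s≤s _)   a = refl
  h-vanishes {suc n} (s≤s n<k) a = trans
    (+-cong (trans (*-congˡ (h-vanishes n<k _)) (zeroʳ _)) (h-vanishes (ℕ.m≤n⇒m≤1+n n<k) _))
    (+-identityˡ 0#)

-- Newton expansion of a power

module _ {c ℓ} (R : CommutativeRing c ℓ) where

  open CommutativeRing R hiding (Carrier; _≈_; _*_; _-_; zero)
  open RingOperators R
  open SemiringSum semiring using (sum; sum-cong-≋; sum-init-last; ∑-distrib-+; *-distribˡ-sum)
  open CommutativeSemigroup *-commutativeSemigroup using (x∙yz≈y∙xz)
  open SetoidReasoning setoid

  private
    factors : Carrier → (Fin n → Carrier) → Fin (suc n) → Carrier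
    factors x a k = ∏[ i < toℕ k ] (x - a (inject! {i = k} i))

    term : Carrier → (Fin n → Carrier) → Fin (suc n) → Carrier
    term {n} x a k = h R n (n ∸ toℕ k) a * factors x a k

    -- The product reads only the entries of `a` before position `k`, so it never meets the last
    -- one, which `a ∘ inject₁` drops.
    factors-inject₁ : ∀ x (a : Fin (suc n) → Carrier) k →
                      factors x a (inject₁ k) ≡ factors x (a ∘ inject₁) k
    factors-inject₁         x a zero    = ≡.refl
    factors-inject₁ {suc n} x a (suc k) = cong ((x - a zero) *_) (factors-inject₁ x (a ∘ suc) k)

    -- The part of term x a k contributed by the second summand in the recursion of h.
    h-term : Carrier → (Fin (suc n) → Carrier) → Fin (suc (suc n)) → Carrier
    h-term {n} x a k = h R n (suc n ∸ toℕ k) (a ∘ suc) * factors x a k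

    -- Below the top index the degree is positive, so the recursion of `h` applies.
    term-inject₁ : ∀ x (a : Fin (suc n) → Carrier) k →
                   term x a (inject₁ k) ≈
                   a zero * term x (a ∘ inject₁) k + h-term x a (inject₁ k)
    term-inject₁ {n} x a k = begin
      h R (suc n) (suc n ∸ toℕ (inject₁ k)) a * F
        ≡⟨ cong (λ d → h R (suc n) d a * F) degree ⟩
      (a zero * H₁ + H₂) * F
        ≈⟨ distribʳ F _ H₂ ⟩
      a zero * H₁ * F + H₂ * F
        ≈⟨ +-congʳ (*-assoc _ H₁ F) ⟩
      a zero * (H₁ * F) + H₂ * F
        ≡⟨ ≡.cong₂ (λ G d → a zero * (H₁ * G) + h R n d (a ∘ suc) * F)
             (factors-inject₁ x a k) (≡.sym degree) ⟩
      a zero * term x (a ∘ inject₁) k + h-term x a (inject₁ k)  ∎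
      where
      H₁ = h R n (n ∸ toℕ k) (a ∘ inject₁)
      H₂ = h R n (suc (n ∸ toℕ k)) (a ∘ suc)
      F  = factors x a (inject₁ k)

      degree : suc n ∸ toℕ (inject₁ k) ≡ suc (n ∸ toℕ k)
      degree = ≡.trans (cong (suc n ∸_) (Fin.toℕ-inject₁ k)) (ℕ.+-∸-assoc 1 (Fin.toℕ≤pred[n] k))

    -- At the top index the degree is 0, and `h` is 1 whatever its variables.
    term-last : ∀ x (a : Fin (suc n) → Carrier) →
                term x a (fromℕ (suc n)) ≈ h-term x a (fromℕ (suc n))
    term-last {n} x a = *-congʳ (h-zero degree)
      where
      degree : n ∸ toℕ (fromℕ n) ≡ 0
      degree = ≡.trans (cong (n ∸_) (Fin.toℕ-fromℕ n)) (ℕ.n∸n≡0 n)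

      h-zero : ∀ {d} → d ≡ 0 → h R (suc n) d a ≈ h R n d (a ∘ suc)
      h-zero ≡.refl = refl

    -- At positive indices `x - a zero` is the first factor of the product; without it a term for
    -- `a ∘ suc` remains.
    sum-h-term : ∀ x (a : Fin (suc n) → Carrier) →
                 sum (h-term x a) ≈ (x - a zero) * sum (term x (a ∘ suc))
    sum-h-term {n} x a = begin
      h-term x a zero + sum (h-term x a ∘ suc)
        -- At index 0 the degree is `n + 1`, but `a ∘ suc` has only `n` variables.
        ≈⟨ +-congʳ (trans (*-congʳ (h-vanishes R (ℕ.n<1+n n) _)) (zeroˡ _)) ⟩
      0# + sum (h-term x a ∘ suc)
        ≈⟨ +-identityˡ _ ⟩
      sum (h-term x a ∘ suc)
        ≈⟨ sum-cong-≋ {suc n} (λ k →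
             x∙yz≈y∙xz (h R n (n ∸ toℕ k) (a ∘ suc)) (x - a zero) (factors x (a ∘ suc) k)) ⟩
      sum (λ k → (x - a zero) * term x (a ∘ suc) k)
        ≈⟨ *-distribˡ-sum (x - a zero) (term x (a ∘ suc)) ⟨
      (x - a zero) * sum (term x (a ∘ suc))  ∎

    -- Every term except the last splits by the recursion of `h`; the last one is exactly what
    -- completes the sum of `h-term`.
    sum-term : ∀ x (a : Fin (suc n) → Carrier) →
               sum (term x a) ≈ a zero * sum (term x (a ∘ inject₁)) + sum (h-term x a)
    sum-term {n} x a = begin
      sum (term x a)
        ≈⟨ sum-init-last (term x a) ⟩
      sum (term x a ∘ inject₁) + term x a (fromℕ (suc n))
        ≈⟨ +-cong (sum-cong-≋ (term-inject₁ x a)) (term-last x a) ⟩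
      sum (λ k → a zero * T k + h-term x a (inject₁ k)) + h-term x a (fromℕ (suc n))
        ≈⟨ +-congʳ (∑-distrib-+ (λ k → a zero * T k) (h-term x a ∘ inject₁)) ⟩
      sum (λ k → a zero * T k) + sum (h-term x a ∘ inject₁) + h-term x a (fromℕ (suc n))
        ≈⟨ +-assoc _ _ _ ⟩
      sum (λ k → a zero * T k) + (sum (h-term x a ∘ inject₁) + h-term x a (fromℕ (suc n)))
        ≈⟨ +-cong (*-distribˡ-sum (a zero) T) (sum-init-last (h-term x a)) ⟨
      a zero * sum T + sum (h-term x a)  ∎
      where T = term x (a ∘ inject₁)

  -- Newton interpolation of the power function: the coefficient is its divided difference at
  -- `a 0, …, a k`. The induction drops the last node in one summand and the first node in the
  -- other.
  newton-expansion : ∀ x n (a : Fin n → Carrier) →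
    x ^ n ≈ ∑[ k ≤ n ] (h R n (n ∸ toℕ k) a * ∏[ i < toℕ k ] (x - a (inject! {i = k} i)))
  newton-expansion x zero    a = sym (trans (+-identityʳ _) (*-identityˡ _))
  newton-expansion x (suc n) a = begin
    x * x ^ n
      ≈⟨ *-congʳ (trans (+-comm y (x - y)) (trans (+-assoc x (- y) y)
           (trans (+-congˡ (-‿inverseˡ y)) (+-identityʳ x)))) ⟨
    (y + (x - y)) * x ^ n
      ≈⟨ distribʳ (x ^ n) y (x - y) ⟩
    y * x ^ n + (x - y) * x ^ n
      ≈⟨ +-cong (*-congˡ (newton-expansion x n (a ∘ inject₁)))
                (*-congˡ (newton-expansion x n (a ∘ suc))) ⟩
    y * sum (term x (a ∘ inject₁)) + (x - y) * sum (term x (a ∘ suc))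
      ≈⟨ +-congˡ (sum-h-term x a) ⟨
    y * sum (term x (a ∘ inject₁)) + sum (h-term x a)
      ≈⟨ sum-term x a ⟨
    sum (term x a)  ∎
    where y = a zero

-- Sums over enumerations and over column choices

module _ {c ℓ} (R : CommutativeRing c ℓ) where

  open CommutativeRing R hiding (zero)
  open RookPolynomials R
  open RingOperators R using (product; _^_)
  open MonoidSum *-monoid using () renaming (sum-cong-≗ to product-cong-≗)
  open Exp semiring using (^-congʳ; ^-homo-*)
  open CommutativeSemigroup *-commutativeSemigroup using (interchange)
  open SetoidReasoning setoid

  private
    ∑ₗ : List A → (A → Carrier) → Carrier
    ∑ₗ xs f = foldr _+_ 0# (List.map f xs)

    -- Restricting the hypothesis to members makes the soundness of an enumeration available inside
    -- a sum.
    ∑ₗ-cong : ∀ (xs : List A) {f g} → (∀ {x} → x ∈ xs → f x ≈ g x) → ∑ₗ xs f ≈ ∑ₗ xs g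
    ∑ₗ-cong []       f≈g = refl
    ∑ₗ-cong (x ∷ xs) f≈g = +-cong (f≈g (here ≡.refl)) (∑ₗ-cong xs (f≈g ∘ there))

    ∑ₗ-map : ∀ (g : A → B) xs {f} → ∑ₗ (List.map g xs) f ≡ ∑ₗ xs (f ∘ g)
    ∑ₗ-map g xs = cong (foldr _+_ 0#) (≡.sym (List.map-∘ xs))

    ∑ₗ-++ : ∀ (xs ys : List A) {f} → ∑ₗ (xs ++ ys) f ≈ ∑ₗ xs f + ∑ₗ ys f
    ∑ₗ-++ []       ys = sym (+-identityˡ _)
    ∑ₗ-++ (x ∷ xs) ys = trans (+-congˡ (∑ₗ-++ xs ys)) (sym (+-assoc _ _ _))

    *-distribˡ-∑ₗ : ∀ y (xs : List A) {f} → y * ∑ₗ xs f ≈ ∑ₗ xs (λ x → y * f x)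
    *-distribˡ-∑ₗ y []       = zeroʳ y
    *-distribˡ-∑ₗ y (x ∷ xs) = trans (distribˡ y _ _) (+-congˡ (*-distribˡ-∑ₗ y xs))

    *-distribʳ-∑ₗ : ∀ y (xs : List A) {f} → ∑ₗ xs f * y ≈ ∑ₗ xs (λ x → f x * y)
    *-distribʳ-∑ₗ y []       = zeroˡ y
    *-distribʳ-∑ₗ y (x ∷ xs) = trans (distribʳ y _ _) (+-congˡ (*-distribʳ-∑ₗ y xs))

    -- The list of pairs is the one built by `Σᴱ`, so this turns a sum over dependent pairs into an
    -- iterated sum.
    ∑ₗ-pairs : ∀ (xs : List A) (ys : A → List B) {f} →
               ∑ₗ (concatMap (λ x → List.map (x ,_) (ys x)) xs) f ≈
               ∑ₗ xs (λ x → ∑ₗ (ys x) (λ y → f (x , y)))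
    ∑ₗ-pairs []       ys = refl
    ∑ₗ-pairs (x ∷ xs) ys =
      trans (∑ₗ-++ (List.map (x ,_) (ys x)) _)
        (+-cong (reflexive (∑ₗ-map (x ,_) (ys x))) (∑ₗ-pairs xs ys))

  -- Distributivity: expanding the product of sums picks one object for each `s`, independently.
  ∑-Π : ∀ {P : Fin k → A → Set ℓ₁} (E : ∀ s → Enumeration (P s)) (f : A → Carrier) →
        ∑ (Πᴱ E) (λ v → product (f ∘ lookup v)) ≈ product (λ s → ∑ (E s) f)
  ∑-Π {k = zero}  E f = +-identityʳ 1#
  ∑-Π {k = suc k} E f = begin
    ∑ (Πᴱ E) (λ v → product (f ∘ lookup v))
      ≡⟨ ∑ₗ-map _ (list (Σᴱ (E zero) (λ _ → Πᴱ (E ∘ suc)))) ⟩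
    ∑ (Σᴱ (E zero) (λ _ → Πᴱ (E ∘ suc))) _
      ≈⟨ ∑ₗ-pairs (list (E zero)) (λ _ → list (Πᴱ (E ∘ suc))) ⟩
    ∑ (E zero) (λ x → ∑ (Πᴱ (E ∘ suc)) (λ v → f x * product (f ∘ lookup v)))
      ≈⟨ ∑ₗ-cong (list (E zero)) (λ {x} _ → trans
           (sym (*-distribˡ-∑ₗ (f x) (list (Πᴱ (E ∘ suc))))) (*-congˡ (∑-Π (E ∘ suc) f))) ⟩
    ∑ (E zero) (λ x → f x * product (λ s → ∑ (E (suc s)) f))
      ≈⟨ *-distribʳ-∑ₗ _ (list (E zero)) ⟨
    ∑ (E zero) f * product (λ s → ∑ (E (suc s)) f)  ∎

  -- The enumeration splits by whether the first column is chosen, which is the recursion of `h`.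
  -- Choosing it cancels one step for every later column, so the last height drops out; avoiding it
  -- drops the first height.
  ∑-increasing : ∀ n k (a : Fin n → Carrier) →
    ∑ (increasing n k) (λ v → product (λ s → a (lookup v s ⊖ toℕ s))) ≈ h R n k a
  ∑-increasing n       zero    a = +-identityʳ 1#
  ∑-increasing zero    (suc k) a = refl
  ∑-increasing (suc n) (suc k) a = begin
    ∑ (increasing (suc n) (suc k)) (f a)
      ≈⟨ ∑ₗ-++ (List.map _ (list (increasing n k))) _ ⟩
    ∑ₗ (List.map (λ w → zero ∷ Vec.map suc w) (list (increasing n k))) (f a) +
    ∑ₗ (List.map (Vec.map suc) (list (increasing n (suc k)))) (f a)
      ≡⟨ ≡.cong₂ _+_ (∑ₗ-map _ (list (increasing n k))) (∑ₗ-map _ (list (increasing n (suc k)))) ⟩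
    ∑ (increasing n k) (λ w → f a (zero ∷ Vec.map suc w)) +
    ∑ (increasing n (suc k)) (f a ∘ Vec.map suc)
      ≈⟨ +-cong
           (trans
             (∑ₗ-cong (list (increasing n k)) (λ {w} _ → *-congˡ (reflexive (uses w))))
             (sym (*-distribˡ-∑ₗ (a zero) (list (increasing n k)))))
           (∑ₗ-cong (list (increasing n (suc k)))
             (λ w∈ → reflexive (avoids (sound (increasing n (suc k)) w∈)))) ⟩
    a zero * ∑ (increasing n k) (f (a ∘ inject₁)) + ∑ (increasing n (suc k)) (f (a ∘ suc))
      ≈⟨ +-cong (*-congˡ (∑-increasing n k (a ∘ inject₁))) (∑-increasing n (suc k) (a ∘ suc)) ⟩
    h R (suc n) (suc k) a  ∎
    where
    f : ∀ {m l} → (Fin m → Carrier) → Vec (Fin m) l → Carrier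
    f a v = product (λ s → a (lookup v s ⊖ toℕ s))

    uses : ∀ w → product (λ s → a (lookup (Vec.map suc w) s ⊖ suc (toℕ s))) ≡
                 f (a ∘ inject₁) w
    -- `suc i ⊖ suc s` is `inject₁ (i ⊖ s)` by definition.
    uses w = product-cong-≗ λ s → cong (λ i → a (i ⊖ suc (toℕ s))) (Vec.lookup-map s suc w)

    avoids : ∀ {w} → IsIncreasing w → f a (Vec.map suc w) ≡ f (a ∘ suc) w
    avoids {w} inc = product-cong-≗ λ s → cong a (≡.trans
      (cong (_⊖ toℕ s) (Vec.lookup-map s suc w))
      (suc-⊖ (lookup w s) (index≤-increasing (VecAll.universal (λ _ → z≤n) w) inc s)))

  -- Rook polynomials as symmetric polynomials

  module _ (p q r : Carrier) where

    weight-++ : ∀ T T′ → weight p q r (T ++ T′) ≈ weight p q r T * weight p q r T′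
    weight-++ T T′ = begin
      weight p q r (T ++ T′)
        ≈⟨ *-cong (*-cong (^-count q one) (^-count p two)) (^-count r three) ⟩
      -- The six powers, grouped by kind of tile, are regrouped by tiling.
      _ ≈⟨ *-congʳ (interchange _ _ _ _) ⟩
      _ ≈⟨ interchange _ _ _ _ ⟩
      weight p q r T * weight p q r T′  ∎
      where
      ^-count : ∀ x t → x ^ count t (T ++ T′) ≈ x ^ count t T * x ^ count t T′
      ^-count x t = trans (^-congʳ x (count-++ t T T′)) (^-homo-* x (count t T) (count t T′))

    weight-concat : (Ts : Vec Tiling k) →
      weight p q r (concat (Vec.toList Ts)) ≈ product (weight p q r ∘ lookup Ts)
    weight-concat []       = trans (*-identityʳ _) (*-identityʳ 1#)
    weight-concat (T ∷ Ts) = trans (weight-++ T (concat (Vec.toList Ts))) (*-congˡ (weight-concat Ts))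

    -- Once the columns are fixed, the tilings in them are chosen independently, so their weights
    -- sum to a product of values of `P`.
    rPT≈h : ∀ {n} (b : Board n) k → rPT k b p q r ≈ h R n k (λ i → P (b i) p q r)
    rPT≈h {n} b k = begin
      rPT k b p q r
        ≈⟨ ∑ₗ-pairs (list (increasing n k)) (λ v → list (Πᴱ (E v))) ⟩
      ∑ (increasing n k) (λ v → ∑ (Πᴱ (E v)) (λ Ts → weight p q r (concat (Vec.toList Ts))))
        ≈⟨ ∑ₗ-cong (list (increasing n k)) (λ {v} _ → trans
             (∑ₗ-cong (list (Πᴱ (E v))) (λ {Ts} _ → weight-concat Ts))
             (∑-Π (E v) (weight p q r))) ⟩
      ∑ (increasing n k) (λ v → product (λ s → P (b (lookup v s ⊖ toℕ s)) p q r))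
        ≈⟨ ∑-increasing n k (λ i → P (b i) p q r) ⟩
      h R n k (λ i → P (b i) p q r)  ∎
      where
      E : (v : Vec (Fin n) k) (s : Fin k) → Enumeration (IsPTiling (b (lookup v s ⊖ toℕ s)))
      E v s = pTilings (b (lookup v s ⊖ toℕ s))

  -- Constants in the polynomial ring

  open Polynomial R using (C; coeffwise) renaming (_≋_ to _≋ₚ_; _*_ to _*ₚ_)
  private module R[X] = CommutativeRing (R [X])

  C-cong : ∀ {x y} → x ≈ y → C x ≋ₚ C y
  C-cong x≈y = coeffwise λ { zero → x≈y ; (suc i) → refl }

  C-* : ∀ x y → C (x * y) ≋ₚ C x *ₚ C y
  C-* x y = coeffwise λ { zero → sym (+-identityʳ _) ; (suc i) → refl }

  -- `h` is built from ring operations, which `C` respects. This links `rPT`, computed in `R`, to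
  -- the expansion taken in `R [X]`.
  C-h : ∀ n k (a : Fin n → Carrier) → C (h R n k a) ≋ₚ h (R [X]) n k (C ∘ a)
  C-h n       zero    a = R[X].refl
  C-h zero    (suc k) a = coeffwise λ { zero → refl ; (suc i) → refl }
  C-h (suc n) (suc k) a = R[X].+-cong
    (R[X].trans (C-* (a zero) _) (R[X].*-congˡ {C (a zero)} (C-h n k (a ∘ inject₁))))
    (C-h n (suc k) (a ∘ suc))

theorem8 : ∀ {c ℓ} (R : CommutativeRing c ℓ) (p q r : CommutativeRing.Carrier R)
    (n : ℕ) (b : Board n) → b Preserves Fin._≤_ ⟶ ℕ._≤_ →
    let open RookPolynomials R
        open Polynomial R using (X)
        open Polynomial R using (C)
        open RingOperators (R [X])
    in X ^ n ≈ ∑[ k ≤ n ] (C (rPT (n ∸ toℕ k) b p q r) *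
                           ∏[ i < toℕ k ] (X - C (P (b (inject! {i = k} i)) p q r)))
theorem8 R p q r n b _ =
  R[X].trans (newton-expansion (R [X]) X n a)
    (sum-cong-≋ {suc n} λ k → R[X].*-congʳ {∏[ i < toℕ k ] (X - a (inject! {i = k} i))}
      (R[X].sym (R[X].trans (C-cong R (rPT≈h R p q r b (n ∸ toℕ k))) (C-h R n (n ∸ toℕ k) _))))
  where
  module R[X] = CommutativeRing (R [X])
  open Polynomial R using (Poly; X; C)
  open RingOperators (R [X]) using (product-syntax; _-_)
  open SemiringSum R[X].semiring using (sum-cong-≋)

  a : Fin n → Poly
  a i = C (RookPolynomials.P R (b i) p q r)
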